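{- Let $S$ be a numerical semigroup and let $k$ be a nonnegative integer with $k<L(S)$. Then $S, A^{\star}(S),\dots,A^{\star k}(S)$ are all almost symmetric numerical semigroups if and only if the following two conditions hold for all integers $i$: (1) if $2i\in[0,k]$, then $t(A^{\star 2i}(S))=2g(S)-m_i(S)-F_{i+1}(S)$; (2) if $2i+1\in[0,k]$, then $t(A^{\star (2i+1)}(S))=F_{i+1}(S)-2g(S)+m_{i+1}(S)$.
   Context: $\mathbb{N}=\{0,1,2,\dots\}$. A numerical semigroup is a subset $S\subseteq\mathbb{N}$ containing $0$, closed under addition, with finite complement in $\mathbb{N}$. The elements of $\mathbb{N}\setminus S$ are the gaps of $S$; the genus $g(S)$ is the number of gaps; for $S\neq\mathbb{N}$ the Frobenius number $F(S)$ is the largest gap. The set of pseudo-Frobenius numbers is $PF(S)=\{x\in\mathbb{N}\setminus S \mid x+s\in S \text{ for all } s\in S\setminus\{0\}\}$, and the type is $t(S)=|PF(S)|$. A numerical semigroup $S\ne\mathbb{N}$ is almost symmetric if $t(S)=2g(S)-F(S)$. For a numerical semigroup $S$, $A^{\star}(S)=S\cup PF(S)$, which is again a numerical semigroup; $A^{\star j}$ denotes the $j$-fold iterate, with $A^{\star 0}(S)=S$ (and $A^{\star}(\mathbb{N})=\mathbb{N}$ for definiteness). $m_0(S)=0$ and for $i\geq 1$, $m_i(S)$ is the $i$-th positive element of $S$ in increasing order; for $1\leq i\leq g(S)$, $F_i(S)$ is the $i$-th largest gap of $S$. Put $l(S)=|S\cap[1,g(S)]|$; then $L(S)=2l(S)$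 if $g(S)\in S$, and $L(S)=2l(S)+1$ if $g(S)\notin S$. (Note $L(S)=0$ if and only if $S=\mathbb{N}$.) -}

module Defs where

open import Level using (0ℓ)
open import Data.Bool.Base using (if_then_else_)
open import Data.Nat using (ℕ; zero; suc; _+_; _*_; _≤_; _≟_)
open import Data.Nat.Properties
  using (+-assoc; +-comm; ≤-trans; m≤n+m; m+n≡0⇒n≡0; ≰⇒>; <⇒≱; _≤?_; allUpTo?)
open import Data.Nat.GeneralisedArithmetic using (fold)
open import Data.Integer as ℤ using (+_)
open import Data.List.Base
  using (List; length; filter; upTo; map; reverse; head; drop)
open import Data.List.Extrema.Nat using (max; xs≤max)
open import Data.List.Membership.Propositional using () renaming (_∈_ to _∈ˡ_)
open import Data.List.Relation.Unary.All using (lookup)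
open import Data.Maybe.Base using (fromMaybe)
open import Data.Product.Base using (∃; _×_; _,_; proj₁; proj₂)
open import Data.Sum.Base using (inj₁; inj₂)
open import Relation.Binary.PropositionalEquality
  using (_≡_; _≢_; refl; sym; subst)
open import Relation.Nullary
  using (¬_; Dec; yes; no; does; ¬?; _×-dec_; _⊎-dec_; _→-dec_; contradiction)
open import Relation.Unary using (Pred; Decidable; _∈_; _∉_; _∪_)

-- Membership is required to be decidable, which classically is no restriction.
record NumericalSemigroup : Set₁ where
  field
    set               : Pred ℕ 0ℓ
    _∈?               : Decidable set
    0∈                : 0 ∈ set
    +-closed          : ∀ {x y} → x ∈ set → y ∈ set → x + y ∈ set
    finite-complement : ∃ λ (xs : List ℕ) → ∀ {x} → x ∉ set → x ∈ˡ xs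

  -- Some number beyond all gaps, used only to bound searches: no quantity
  -- defined below depends on which one it is.
  bound : ℕ
  bound = suc (max 0 (proj₁ finite-complement))

  bound≤⇒∈ : ∀ {x} → bound ≤ x → x ∈ set
  bound≤⇒∈ {x} b≤x with x ∈?
  ... | yes x∈ = x∈
  ... | no  x∉ = contradiction
    (lookup (xs≤max 0 (proj₁ finite-complement)) (proj₂ finite-complement x∉))
    (<⇒≱ b≤x)

open NumericalSemigroup using (set; bound; bound≤⇒∈)

member? : (S : NumericalSemigroup) → Decidable (set S)
member? = NumericalSemigroup._∈?

IsWhole : NumericalSemigroup → Set
IsWhole S = ∀ n → n ∈ set S

gaps : NumericalSemigroup → List ℕ
gaps S = filter (λ n → ¬? (member? S n)) (upTo (bound S))

genus : NumericalSemigroup → ℕ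
genus S = length (gaps S)

-- The default 0 is returned only for S = ℕ.
frobenius : NumericalSemigroup → ℕ
frobenius S = max 0 (gaps S)

PF : NumericalSemigroup → Pred ℕ 0ℓ
PF S x = x ∉ set S × (∀ s → s ∈ set S → s ≢ 0 → x + s ∈ set S)

-- It suffices to test s < bound S.
PF? : (S : NumericalSemigroup) → Decidable (PF S)
PF? S x = ¬? (member? S x) ×-dec shifts?
  where
  Shift : ℕ → Set
  Shift s = s ∈ set S → s ≢ 0 → x + s ∈ set S

  Shift? : Decidable Shift
  Shift? s = member? S s →-dec (¬? (s ≟ 0) →-dec member? S (x + s))

  shifts? : Dec (∀ s → Shift s)
  shifts? with allUpTo? Shift? (bound S)
  ... | no ¬small = no λ all → ¬small λ {s} _ → all s
  ... | yes small = yes λ s → go s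
    where
    go : ∀ s → Shift s
    go s with bound S ≤? s
    ... | yes b≤s = λ _ _ → bound≤⇒∈ S (≤-trans b≤s (m≤n+m s x))
    ... | no  b≰s = small (≰⇒> b≰s)

type : NumericalSemigroup → ℕ
type S = length (filter (PF? S) (upTo (bound S)))

AlmostSymmetric : NumericalSemigroup → Set
AlmostSymmetric S =
  ¬ IsWhole S × + type S ≡ + (2 * genus S) ℤ.- + frobenius S

A⋆ : NumericalSemigroup → NumericalSemigroup
A⋆ S = record
  { set               = set S ∪ PF S
  ; _∈?               = λ x → member? S x ⊎-dec PF? S x
  ; 0∈                = inj₁ (NumericalSemigroup.0∈ S)
  ; +-closed          = closed
  ; finite-complement =
      proj₁ (NumericalSemigroup.finite-complement S) ,
      λ x∉ → proj₂ (NumericalSemigroup.finite-complement S) (λ x∈ → x∉ (inj₁ x∈))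
  }
  where
  S+S = NumericalSemigroup.+-closed S

  S+PF : ∀ {x y} → x ∈ set S → y ∈ PF S → y + x ∈ set S ∪ PF S
  S+PF {x} {y} x∈ y∈ with x ≟ 0
  ... | yes refl = inj₂ (subst (PF S) (+-comm 0 y) y∈)
  ... | no  x≢0  = inj₁ (proj₂ y∈ x x∈ x≢0)

  closed : ∀ {x y} → x ∈ set S ∪ PF S → y ∈ set S ∪ PF S → x + y ∈ set S ∪ PF S
  closed (inj₁ x∈) (inj₁ y∈) = inj₁ (S+S x∈ y∈)
  closed {x} {y} (inj₁ x∈) (inj₂ y∈) =
    subst (set S ∪ PF S) (+-comm y x) (S+PF x∈ y∈)
  closed (inj₂ x∈) (inj₁ y∈) = S+PF y∈ x∈
  closed {x} {y} (inj₂ x∈) (inj₂ y∈) with member? S (x + y)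
  ... | yes x+y∈ = inj₁ x+y∈
  ... | no  x+y∉ = inj₂ (x+y∉ , λ s s∈ s≢0 →
    subst (set S) (sym (+-assoc x y s))
      (proj₂ x∈ (y + s) (proj₂ y∈ s s∈ s≢0) (λ eq → s≢0 (m+n≡0⇒n≡0 y eq))))

A⋆^ : ℕ → NumericalSemigroup → NumericalSemigroup
A⋆^ j S = fold S A⋆ j

-- Entry in position i, counting from 0; the default 0 if there is none.
entry : List ℕ → ℕ → ℕ
entry xs i = fromMaybe 0 (head (drop i xs))

-- The elements of S below bound S + suc i, in increasing order, start with 0
-- and number at least suc i, so position i holds the i-th positive element.
m : NumericalSemigroup → ℕ → ℕ
m S i = entry (filter (member? S) (upTo (bound S + suc i))) i

-- Meaningful for 1 ≤ i ≤ genus S, and 0 otherwise.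
F : NumericalSemigroup → ℕ → ℕ
F S zero    = 0
F S (suc i) = entry (reverse (gaps S)) i

l : NumericalSemigroup → ℕ
l S = length (filter (member? S) (map suc (upTo (genus S))))

L : NumericalSemigroup → ℕ
L S = if does (member? S (genus S)) then 2 * l S else 2 * l S + 1

{-# OPTIONS --safe #-}
module Submission where

-- If T is almost symmetric with Frobenius number f, then the f − s with
-- s ∈ T and 0 < s ≤ f are gaps of A⋆ T, and there are as many of them as A⋆ T
-- has gaps, namely f − g(T); hence they are all the gaps of A⋆ T.
-- Reflecting repeatedly, as long as the previous iterates are almost symmetric,
--   the gaps of A⋆^(2i) S   are the y − m_i     with y ∉ S, m_i ≤ y ≤ F_{i+1},
--   the gaps of A⋆^(2i+1) S are the F_{i+1} − u with u ∈ S, m_{i+1} ≤ u ≤ F_{i+1},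
-- so that genus and Frobenius number of A⋆^j S are known and almost symmetry of
-- A⋆^j S becomes the j-th equation.  The bound k < L S keeps m_i and m_{i+1} below
-- F_{i+1}, which makes A⋆^j S ≠ ℕ for all j ≤ k.

open import Defs
open import Data.Nat using (ℕ; _+_; _*_; _≤_; _<_)
open import Data.Integer as ℤ using (+_)
open import Data.Product using (_×_)
open import Function.Bundles using (_⇔_)
open import Relation.Binary.PropositionalEquality using (_≡_)

open import Data.Bool.Base using (true; false; if_then_else_)
open import Data.List.Base
  using (List; []; _∷_; _++_; _∷ʳ_; length; filter; upTo; map; applyUpTo; reverse)
open import Data.List.Extrema.Nat using (max≈v⁺)
open import Data.List.Membership.Propositional.Properties
  using (∈-filter⁺; ∈-filter⁻; ∈-upTo⁺)
open import Data.List.Properties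
  using (upTo-∷ʳ; map-upTo; applyUpTo-∷ʳ; length-++; filter-++; reverse-++; ++-identityʳ)
open import Data.List.Relation.Unary.All using (tabulate)
open import Data.Nat
  using (zero; suc; _∸_; z≤n; s≤s; s<s⁻¹)
open import Data.Nat.Induction using (<-rec)
open import Data.Nat.Properties
open import Data.Nat.Tactic.RingSolver using () renaming (solve-∀ to ℕ-solve-∀)
open import Data.Integer.Tactic.RingSolver using () renaming (solve-∀ to ℤ-solve-∀)
import Data.Integer.Properties as ℤ
open import Data.Product using (∃; _,_; proj₁; proj₂)
open import Data.Sum using (_⊎_; inj₁; inj₂; [_,_]′)
open import Function using (_∘_; id; case_of_)
open import Function.Bundles using (mk⇔; Equivalence)
open import Level using (Level; 0ℓ)
open import Relation.Binary.PropositionalEquality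
  using (_≢_; refl; sym; trans; cong; cong₂; subst; subst₂; module ≡-Reasoning)
open import Relation.Nullary
  using (¬_; Dec; yes; no; does; ¬?; _×-dec_; contradiction)
open import Relation.Nullary.Decidable using (decidable-stable)
open import Relation.Unary using (Pred; Decidable; _∈_; _∉_; ∁)

open NumericalSemigroup using (set; bound; bound≤⇒∈; 0∈; +-closed)

private variable
  p q r : Level
  P : Pred ℕ p
  Q : Pred ℕ q
  R : Pred ℕ r

-- Counting

⟦_⟧ : {A : Set p} → Dec A → ℕ
⟦ d ⟧ = if does d then 1 else 0

-- The largest candidate is split off first, matching `upTo (suc n)` as `upTo n` with `n` appended.
-- Lists enter only through `length-filter-upTo` and the two descriptions of `entry` below.
count : Decidable P → ℕ → ℕ
count P? zero    = 0
count P? (suc n) = ⟦ P? n ⟧ + count P? n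

length-filter-∷ʳ : (P? : Decidable P) (xs : List ℕ) (n : ℕ) →
  length (filter P? (xs ∷ʳ n)) ≡ ⟦ P? n ⟧ + length (filter P? xs)
length-filter-∷ʳ P? xs n = begin
  length (filter P? (xs ∷ʳ n))
    ≡⟨ cong length (filter-++ P? xs (n ∷ [])) ⟩
  length (filter P? xs ++ filter P? (n ∷ []))
    ≡⟨ length-++ (filter P? xs) ⟩
  length (filter P? xs) + length (filter P? (n ∷ []))
    ≡⟨ +-comm (length (filter P? xs)) _ ⟩
  length (filter P? (n ∷ [])) + length (filter P? xs)
    ≡⟨ cong (_+ length (filter P? xs)) single ⟩
  ⟦ P? n ⟧ + length (filter P? xs) ∎
  where
  open ≡-Reasoning
  single : length (filter P? (n ∷ [])) ≡ ⟦ P? n ⟧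
  single with does (P? n)
  ... | true  = refl
  ... | false = refl

length-filter-applyUpTo : (f : ℕ → ℕ) (P? : Decidable P) (n : ℕ) →
  length (filter P? (applyUpTo f n)) ≡ count (P? ∘ f) n
length-filter-applyUpTo f P? zero    = refl
length-filter-applyUpTo f P? (suc n) = begin
  length (filter P? (applyUpTo f (suc n)))
    ≡⟨ cong (length ∘ filter P?) (applyUpTo-∷ʳ f n) ⟨
  length (filter P? (applyUpTo f n ∷ʳ f n))
    ≡⟨ length-filter-∷ʳ P? (applyUpTo f n) (f n) ⟩
  ⟦ P? (f n) ⟧ + length (filter P? (applyUpTo f n))
    ≡⟨ cong (λ z → ⟦ P? (f n) ⟧ + z) (length-filter-applyUpTo f P? n) ⟩
  count (P? ∘ f) (suc n) ∎
  where open ≡-Reasoning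

length-filter-upTo : (P? : Decidable P) (n : ℕ) →
  length (filter P? (upTo n)) ≡ count P? n
length-filter-upTo = length-filter-applyUpTo id

count-yes : (P? : Decidable P) {n : ℕ} → P n → count P? (suc n) ≡ suc (count P? n)
count-yes P? {n} pn with P? n
... | yes _  = refl
... | no ¬pn = contradiction pn ¬pn

count-no : (P? : Decidable P) {n : ℕ} → ¬ P n → count P? (suc n) ≡ count P? n
count-no P? {n} ¬pn with P? n
... | yes pn = contradiction pn ¬pn
... | no  _  = refl

count-+ˡ : (P? : Decidable P) (k n : ℕ) → count P? n ≤ count P? (k + n)
count-+ˡ P? zero    n = ≤-refl
count-+ˡ P? (suc k) n = ≤-trans (count-+ˡ P? k n) (m≤n+m _ ⟦ P? (k + n) ⟧)

count-mono : (P? : Decidable P) {m n : ℕ} → m ≤ n → count P? m ≤ count P? n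
count-mono P? {m} {n} m≤n =
  subst (λ z → count P? m ≤ count P? z) (m∸n+n≡m m≤n) (count-+ˡ P? (n ∸ m) m)

count-mono-< : (P? : Decidable P) {m n : ℕ} → P m → m < n → count P? m < count P? n
count-mono-< P? {m} {n} pm m<n =
  subst (_≤ count P? n) (count-yes P? pm) (count-mono P? m<n)

count-cancel-< : (P? : Decidable P) {m n : ℕ} → count P? m < count P? n → m < n
count-cancel-< P? {m} {n} c<c = ≰⇒> λ n≤m → <⇒≱ c<c (count-mono P? n≤m)

count-cancel-≤ : (P? : Decidable P) {m n : ℕ} → P n → count P? m ≤ count P? n → m ≤ n
count-cancel-≤ P? pn c≤c = ≮⇒≥ λ n<m → <⇒≱ (count-mono-< P? pn n<m) c≤c

count-⊆ : (P? : Decidable P) (Q? : Decidable Q) (n : ℕ) →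
  (∀ {x} → x < n → P x → Q x) → count P? n ≤ count Q? n
count-⊆ P? Q? zero    P⊆Q = z≤n
count-⊆ P? Q? (suc n) P⊆Q with P? n | Q? n | count-⊆ P? Q? n (P⊆Q ∘ m<n⇒m<1+n)
... | yes _  | yes _  | c≤c = s≤s c≤c
... | yes pn | no ¬qn | c≤c = contradiction (P⊆Q ≤-refl pn) ¬qn
... | no _   | yes _  | c≤c = m≤n⇒m≤1+n c≤c
... | no _   | no _   | c≤c = c≤c

count-cong : (P? : Decidable P) (Q? : Decidable Q) (n : ℕ) →
  (∀ {x} → x < n → P x → Q x) → (∀ {x} → x < n → Q x → P x) →
  count P? n ≡ count Q? n
count-cong P? Q? n P⊆Q Q⊆P = ≤-antisym (count-⊆ P? Q? n P⊆Q) (count-⊆ Q? P? n Q⊆P)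

-- Finite sets of equal size, one inside the other, coincide: if only `Q` held at the top number,
-- `P` would have to outnumber `Q` below it, against `count-⊆`.
count-⊆-≡ : (P? : Decidable P) (Q? : Decidable Q) (n : ℕ) →
  (∀ {x} → P x → Q x) → count P? n ≡ count Q? n →
  ∀ {x} → x < n → Q x → P x
count-⊆-≡ P? Q? (suc n) P⊆Q c≡c {x} x<1+n qx
  with P? n | Q? n | count-⊆ P? Q? n (λ _ → P⊆Q) | m<1+n⇒m<n∨m≡n x<1+n
... | yes pn | _      | _   | inj₂ refl = pn
... | no _   | no ¬qn | _   | inj₂ refl = contradiction qx ¬qn
... | no _   | yes _  | c≤c | _         = contradiction (≤-reflexive (sym c≡c)) (≤⇒≯ c≤c)
... | yes pn | no ¬qn | _   | inj₁ _    = contradiction (P⊆Q pn) ¬qn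
... | yes _  | yes _  | _   | inj₁ x<n  =
  count-⊆-≡ P? Q? n P⊆Q (suc-injective c≡c) x<n qx
... | no _   | no _   | _   | inj₁ x<n  = count-⊆-≡ P? Q? n P⊆Q c≡c x<n qx

count-⊎ : (P? : Decidable P) (Q? : Decidable Q) (R? : Decidable R) (n : ℕ) →
  (∀ {x} → P x → Q x ⊎ R x) → (∀ {x} → Q x → P x) → (∀ {x} → R x → P x) →
  (∀ {x} → Q x → ¬ R x) →
  count P? n ≡ count Q? n + count R? n
count-⊎ P? Q? R? zero    P⊆ Q⊆ R⊆ disj = refl
count-⊎ P? Q? R? (suc n) P⊆ Q⊆ R⊆ disj
  with P? n | Q? n | R? n | count-⊎ P? Q? R? n P⊆ Q⊆ R⊆ disj
... | yes _  | yes _  | no _   | eq = cong suc eq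
... | yes _  | no _   | yes _  | eq = trans (cong suc eq) (sym (+-suc _ _))
... | no _   | no _   | no _   | eq = eq
... | _      | yes qn | yes rn | _  = contradiction rn (disj qn)
... | yes pn | no ¬qn | no ¬rn | _  = contradiction (P⊆ pn) [ ¬qn , ¬rn ]′
... | no ¬pn | yes qn | no _   | _  = contradiction (Q⊆ qn) ¬pn
... | no ¬pn | no _   | yes rn | _  = contradiction (R⊆ rn) ¬pn

count-∁ : (P? : Decidable P) (n : ℕ) → count P? n + count (¬? ∘ P?) n ≡ n
count-∁ P? zero    = refl
count-∁ P? (suc n) with P? n | count-∁ P? n
... | yes _ | eq = cong suc eq
... | no  _ | eq = trans (+-suc _ _) (cong suc eq)

count-stable : (P? : Decidable P) {m n : ℕ} → m ≤ n → (∀ {x} → m ≤ x → ¬ P x) →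
  count P? n ≡ count P? m
count-stable P? {m} {n} m≤n ¬P =
  subst (λ z → count P? z ≡ count P? m) (m∸n+n≡m m≤n) (go (n ∸ m))
  where
  go : ∀ k → count P? (k + m) ≡ count P? m
  go zero    = refl
  go (suc k) = trans (count-no P? (¬P (m≤n+m m k))) (go k)

count-head : (P? : Decidable P) (n : ℕ) →
  count P? (suc n) ≡ ⟦ P? 0 ⟧ + count (P? ∘ suc) n
count-head P? zero    = refl
count-head P? (suc n) = begin
  ⟦ P? (suc n) ⟧ + count P? (suc n)
    ≡⟨ cong (λ z → ⟦ P? (suc n) ⟧ + z) (count-head P? n) ⟩
  ⟦ P? (suc n) ⟧ + (⟦ P? 0 ⟧ + count (P? ∘ suc) n)
    ≡⟨ swap ⟦ P? (suc n) ⟧ ⟦ P? 0 ⟧ (count (P? ∘ suc) n) ⟩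
  ⟦ P? 0 ⟧ + (⟦ P? (suc n) ⟧ + count (P? ∘ suc) n) ∎
  where
  open ≡-Reasoning
  swap : ∀ x y z → x + (y + z) ≡ y + (x + z)
  swap = ℕ-solve-∀

-- The map x ↦ n - x carries 0, ..., n - 1 onto 1, ..., n in reverse, so the induction removes the
-- first term on the left and the last one on the right.
count-reflect : (P? : Decidable P) (n : ℕ) →
  count (λ x → P? (n ∸ x)) n ≡ count (P? ∘ suc) n
count-reflect P? zero    = refl
count-reflect P? (suc n) =
  trans (count-head (λ x → P? (suc n ∸ x)) n)
        (cong (λ z → ⟦ P? (suc n) ⟧ + z) (count-reflect P? n))

-- The entries of a filtered list

entry-++ˡ : (xs ys : List ℕ) {i : ℕ} → i < length xs → entry (xs ++ ys) i ≡ entry xs i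
entry-++ˡ (x ∷ xs) ys {zero}  _   = refl
entry-++ˡ (x ∷ xs) ys {suc i} i<n = entry-++ˡ xs ys (s<s⁻¹ i<n)

entry-∷ʳ : (xs : List ℕ) (y : ℕ) → entry (xs ∷ʳ y) (length xs) ≡ y
entry-∷ʳ []       y = refl
entry-∷ʳ (x ∷ xs) y = entry-∷ʳ xs y

filter-upTo-yes : (P? : Decidable P) {n : ℕ} → P n →
  filter P? (upTo (suc n)) ≡ filter P? (upTo n) ∷ʳ n
filter-upTo-yes P? {n} pn = trans (cong (filter P?) (sym (upTo-∷ʳ n)))
  (trans (filter-++ P? (upTo n) (n ∷ [])) (cong (filter P? (upTo n) ++_) single))
  where
  single : filter P? (n ∷ []) ≡ n ∷ []
  single with P? n
  ... | yes _  = refl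
  ... | no ¬pn = contradiction pn ¬pn

filter-upTo-no : (P? : Decidable P) {n : ℕ} → ¬ P n →
  filter P? (upTo (suc n)) ≡ filter P? (upTo n)
filter-upTo-no P? {n} ¬pn = trans (cong (filter P?) (sym (upTo-∷ʳ n)))
  (trans (filter-++ P? (upTo n) (n ∷ []))
    (trans (cong (filter P? (upTo n) ++_) single) (++-identityʳ _)))
  where
  single : filter P? (n ∷ []) ≡ []
  single with P? n
  ... | yes pn = contradiction pn ¬pn
  ... | no _   = refl

-- An entry is determined by its rank. This replaces positions in lists by counts, the form in which
-- `m` is used from here on; the reversed version below does the same for `F`.
entry-filter : (P? : Decidable P) (n : ℕ) {i : ℕ} → i < count P? n →
  let e = entry (filter P? (upTo n)) i in P e × count P? e ≡ i
entry-filter {P = P} P? (suc n) {i} i<c with P? n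
... | no ¬pn rewrite filter-upTo-no P? ¬pn = entry-filter P? n i<c
... | yes pn rewrite filter-upTo-yes P? pn with m<1+n⇒m<n∨m≡n i<c
...   | inj₁ i<c′ = subst (λ e → P e × count P? e ≡ i)
  (sym (entry-++ˡ (filter P? (upTo n)) (n ∷ [])
    (subst (i <_) (sym (length-filter-upTo P? n)) i<c′)))
  (entry-filter P? n i<c′)
-- Here `i` is the length of the list before `n` was appended, so the entry is `n` itself.
...   | inj₂ refl = subst (λ e → P e × count P? e ≡ i)
  (sym (trans (cong (entry (filter P? (upTo n) ∷ʳ n)) (sym (length-filter-upTo P? n)))
              (entry-∷ʳ (filter P? (upTo n)) n)))
  (pn , refl)

entry-reverse-filter : (P? : Decidable P) (n : ℕ) {i : ℕ} → i < count P? n →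
  let e = entry (reverse (filter P? (upTo n))) i in
  P e × count P? e + suc i ≡ count P? n
entry-reverse-filter P? (suc n) {i} i<c with P? n
... | no ¬pn rewrite filter-upTo-no P? ¬pn = entry-reverse-filter P? n i<c
entry-reverse-filter P? (suc n) {zero} i<c | yes pn
  rewrite filter-upTo-yes P? pn | reverse-++ (filter P? (upTo n)) (n ∷ []) =
  pn , +-comm _ 1
entry-reverse-filter P? (suc n) {suc i} i<c | yes pn
  rewrite filter-upTo-yes P? pn | reverse-++ (filter P? (upTo n)) (n ∷ [])
  with pe , eq ← entry-reverse-filter P? n (s<s⁻¹ i<c) =
  pe , trans (+-suc _ (suc i)) (cong suc eq)

-- Gaps, genus and Frobenius number

private variable
  S T : NumericalSemigroup
  a b f f′ i : ℕ

gap? : (S : NumericalSemigroup) → Decidable (∁ (set S))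
gap? S = ¬? ∘ member? S

elementsBelow : NumericalSemigroup → ℕ → ℕ
elementsBelow S = count (member? S)

gapsBelow : NumericalSemigroup → ℕ → ℕ
gapsBelow S = count (gap? S)

gap<bound : (S : NumericalSemigroup) {x : ℕ} → x ∉ set S → x < bound S
gap<bound S x∉S = ≰⇒> λ b≤x → x∉S (bound≤⇒∈ S b≤x)

gapsBelow-bound : (S : NumericalSemigroup) → gapsBelow S (bound S) ≡ genus S
gapsBelow-bound S = sym (length-filter-upTo (gap? S) (bound S))

gapsBelow-beyond : (S : NumericalSemigroup) {n : ℕ} → bound S ≤ n → gapsBelow S n ≡ genus S
gapsBelow-beyond S b≤n =
  trans (count-stable (gap? S) b≤n (λ b≤x x∉S → x∉S (bound≤⇒∈ S b≤x))) (gapsBelow-bound S)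

gapsBelow<genus : (S : NumericalSemigroup) {x : ℕ} → x ∉ set S → gapsBelow S x < genus S
gapsBelow<genus S {x} x∉S = subst (gapsBelow S x <_) (gapsBelow-bound S)
  (count-mono-< (gap? S) x∉S (gap<bound S x∉S))

elementsBelow-suc : (S : NumericalSemigroup) (n : ℕ) →
  elementsBelow S (suc n) ≡ suc (count (member? S ∘ suc) n)
elementsBelow-suc S n = trans (count-head (member? S) n)
  (cong (λ z → z + count (member? S ∘ suc) n) zero-counts)
  where
  zero-counts : ⟦ member? S 0 ⟧ ≡ 1
  zero-counts with member? S 0
  ... | yes _  = refl
  ... | no 0∉S = contradiction (0∈ S) 0∉S

-- Unlike `frobenius`, which defaults to 0, this holds for no `f` when S = ℕ, so a proof of it also
-- records S ≠ ℕ.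
IsFrobenius : NumericalSemigroup → ℕ → Set
IsFrobenius S f = f ∉ set S × (∀ {x} → x ∉ set S → x ≤ f)

frobenius-unique : IsFrobenius S f → frobenius S ≡ f
frobenius-unique {S} (f∉S , f-max) = max≈v⁺
  (∈-filter⁺ (gap? S) (∈-upTo⁺ (gap<bound S f∉S)) f∉S)
  (tabulate λ x∈ → f-max (proj₂ (∈-filter⁻ (gap? S) {xs = upTo (bound S)} x∈)))
  z≤n

gapsBelow-frobenius : IsFrobenius S f → gapsBelow S (suc f) ≡ genus S
gapsBelow-frobenius {S} (f∉S , f-max) = trans
  (sym (count-stable (gap? S) (gap<bound S f∉S) (λ f<x x∉S → <⇒≱ f<x (f-max x∉S))))
  (gapsBelow-bound S)

-- Almost symmetry

-- The gaps of T split into the pseudo-Frobenius numbers, which A⋆ fills, and the gaps that survive.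
genus-A⋆ : (T : NumericalSemigroup) → genus T ≡ genus (A⋆ T) + type T
genus-A⋆ T = begin
  genus T
    ≡⟨ length-filter-upTo (gap? T) (bound T) ⟩
  count (gap? T) (bound T)
    ≡⟨ count-⊎ (gap? T) (gap? (A⋆ T)) (PF? T) (bound T) split
         (λ x∉A⋆ x∈T → x∉A⋆ (inj₁ x∈T)) proj₁ (λ x∉A⋆ x∈PF → x∉A⋆ (inj₂ x∈PF)) ⟩
  count (gap? (A⋆ T)) (bound T) + count (PF? T) (bound T)
    -- `A⋆` keeps the list witnessing finite complement, so `bound (A⋆ T)` is `bound T` by
    -- computation.
    ≡⟨ cong₂ _+_ (length-filter-upTo (gap? (A⋆ T)) (bound T))
                 (length-filter-upTo (PF? T) (bound T)) ⟨
  genus (A⋆ T) + type T ∎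
  where
  open ≡-Reasoning
  split : ∀ {x} → x ∉ set T → x ∉ set (A⋆ T) ⊎ PF T x
  split {x} x∉T with PF? T x
  ... | yes x∈PF = inj₂ x∈PF
  ... | no x∉PF  = inj₁ [ x∉T , x∉PF ]′

m≡n-o⇒m+o≡n : ∀ {m n o} → + m ≡ + n ℤ.- + o → m + o ≡ n
m≡n-o⇒m+o≡n {m} {n} {o} eq =
  ℤ.+-injective (trans (cong (ℤ._+ + o) eq) (cancel (+ n) (+ o)))
  where
  cancel : ∀ x y → x ℤ.- y ℤ.+ y ≡ x
  cancel = ℤ-solve-∀

-- Substitute t = 2g - f into g = g(A⋆ T) + t.
genus-A⋆-almostSymmetric : IsFrobenius T f → AlmostSymmetric T →
  genus (A⋆ T) + genus T ≡ f
genus-A⋆-almostSymmetric {T} {f} frob (_ , type≡) = +-cancelˡ-≡ (type T) _ _ (begin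
  type T + (genus (A⋆ T) + genus T) ≡⟨ rearrange (type T) (genus (A⋆ T)) (genus T) ⟩
  (genus (A⋆ T) + type T) + genus T ≡⟨ cong (_+ genus T) (genus-A⋆ T) ⟨
  genus T + genus T                 ≡⟨ double (genus T) ⟩
  2 * genus T                       ≡⟨ m≡n-o⇒m+o≡n type≡ ⟨
  type T + frobenius T              ≡⟨ cong (λ z → type T + z) (frobenius-unique {T} frob) ⟩
  type T + f                        ∎)
  where
  open ≡-Reasoning
  rearrange : ∀ x y z → x + (y + z) ≡ (y + x) + z
  rearrange = ℕ-solve-∀
  double : ∀ x → x + x ≡ 2 * x
  double = ℕ-solve-∀

module _ {T : NumericalSemigroup} {f : ℕ} (frob : IsFrobenius T f) where

  -- These x are the f - s with s in T and 0 < s ≤ f. The condition `x < f` keeps s positive;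
  -- without it truncated subtraction would give s = 0, an element of T, for every x ≥ f.
  Reflected : Pred ℕ 0ℓ
  Reflected x = x < f × f ∸ x ∈ set T

  Reflected? : Decidable Reflected
  Reflected? x = (x <? f) ×-dec member? T (f ∸ x)

  -- Adding a nonzero element of T to an element of A⋆ T lands in T, whereas x + s is the gap f.
  reflected⇒gap : ∀ {s x} → s ∈ set T → s ≢ 0 → x + s ≡ f → x ∉ set (A⋆ T)
  reflected⇒gap s∈T s≢0 refl (inj₁ x∈T)        = proj₁ frob (+-closed T x∈T s∈T)
  reflected⇒gap s∈T s≢0 refl (inj₂ (_ , x+s∈)) = proj₁ frob (x+s∈ _ s∈T s≢0)

  Reflected⊆gaps : ∀ {x} → Reflected x → x ∉ set (A⋆ T)
  Reflected⊆gaps (x<f , f∸x∈T) =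
    reflected⇒gap f∸x∈T (m<n⇒n≢0 (m<n⇒0<n∸m x<f)) (m+[n∸m]≡n (<⇒≤ x<f))

  -- The numbers 0, ..., f consist of 0, the positive elements of T up to f, which are the
  -- reflections of the `Reflected` numbers, and all gaps of T. The outer `suc` accounts for 0.
  count-Reflected : count Reflected? (bound T) + genus T ≡ f
  count-Reflected = suc-injective (begin
    suc (count Reflected? (bound T) + genus T)
      ≡⟨ cong (λ z → suc (z + genus T)) (count-stable Reflected? (<⇒≤ (gap<bound T (proj₁ frob)))
           (λ f≤x x∈R → <⇒≱ (proj₁ x∈R) f≤x)) ⟩
    suc (count Reflected? f + genus T)
      ≡⟨ cong (λ z → suc (z + genus T)) (count-cong Reflected? (λ x → member? T (f ∸ x)) f
           (λ _ → proj₂) _,_) ⟩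
    suc (count (λ x → member? T (f ∸ x)) f + genus T)
      ≡⟨ cong (λ z → suc (z + genus T)) (count-reflect (member? T) f) ⟩
    suc (count (member? T ∘ suc) f + genus T)
      ≡⟨ cong₂ _+_ (elementsBelow-suc T f) (gapsBelow-frobenius {T} frob) ⟨
    elementsBelow T (suc f) + gapsBelow T (suc f)
      ≡⟨ count-∁ (member? T) (suc f) ⟩
    suc f ∎)
    where open ≡-Reasoning

  -- By almost symmetry the inclusion Reflected⊆gaps is between finite sets of
  -- the same size.
  gap⇒reflected : AlmostSymmetric T → ∀ {x} → x ∉ set (A⋆ T) →
    ∃ λ s → s ∈ set T × s ≢ 0 × x + s ≡ f
  gap⇒reflected as {x} x∉A⋆ = f ∸ x , proj₂ x∈R , m<n⇒n≢0 (m<n⇒0<n∸m (proj₁ x∈R)) ,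
    m+[n∸m]≡n (<⇒≤ (proj₁ x∈R))
    where
    same-count : count Reflected? (bound T) ≡ count (gap? (A⋆ T)) (bound T)
    same-count = +-cancelʳ-≡ (genus T) _ _ (trans count-Reflected
      (sym (trans (cong (_+ genus T) (gapsBelow-bound (A⋆ T)))
                  (genus-A⋆-almostSymmetric {T} frob as))))
    x∈R : Reflected x
    x∈R = count-⊆-≡ Reflected? (gap? (A⋆ T)) (bound T) Reflected⊆gaps same-count
      (gap<bound (A⋆ T) x∉A⋆) x∉A⋆

-- The elements m_i and the gaps F_{i+1}

-- Since 0 belongs to S, the i-th positive element has exactly i elements below it.
NthElement : NumericalSemigroup → ℕ → ℕ → Set
NthElement S i a = a ∈ set S × elementsBelow S a ≡ i

-- This is F_{i+1}: the summand `suc i` stands for the gap itself and the i gaps above it, which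
-- avoids a truncated subtraction.
NthGap : NumericalSemigroup → ℕ → ℕ → Set
NthGap S i f = f ∉ set S × gapsBelow S f + suc i ≡ genus S

-- At most `bound S` of the numbers below `bound S + suc i` are gaps, so at least i + 1 are elements
-- and position i is not the default.
m-nth : (S : NumericalSemigroup) (i : ℕ) → NthElement S i (m S i)
m-nth S i = entry-filter (member? S) n (+-cancelʳ-≤ (bound S) (suc i) _ (begin
  suc i + bound S                 ≡⟨ +-comm (suc i) (bound S) ⟩
  n                               ≡⟨ count-∁ (member? S) n ⟨
  elementsBelow S n + gapsBelow S n ≡⟨ cong (λ z → elementsBelow S n + z)
                                        (gapsBelow-beyond S (m≤m+n (bound S) (suc i))) ⟩
  elementsBelow S n + genus S     ≤⟨ +-monoʳ-≤ _ genus≤bound ⟩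
  elementsBelow S n + bound S     ∎))
  where
  open ≤-Reasoning
  n : ℕ
  n = bound S + suc i
  genus≤bound : genus S ≤ bound S
  genus≤bound = begin
    genus S                                         ≡⟨ gapsBelow-bound S ⟨
    gapsBelow S (bound S)                           ≤⟨ m≤n+m _ (elementsBelow S (bound S)) ⟩
    elementsBelow S (bound S) + gapsBelow S (bound S) ≡⟨ count-∁ (member? S) (bound S) ⟩
    bound S                                         ∎

F-nth : (S : NumericalSemigroup) {i : ℕ} → i < genus S → NthGap S i (F S (suc i))
F-nth S i<g with f∉S , eq ← entry-reverse-filter (gap? S) (bound S)
    (subst (_ <_) (sym (gapsBelow-bound S)) i<g) =
  f∉S , trans eq (gapsBelow-bound S)

nthElement-suc-< : NthElement S i a → NthElement S (suc i) b → a < b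
nthElement-suc-< {S} (_ , #a) (_ , #b) =
  count-cancel-< (member? S) (subst (_< _) (sym #a) (≤-reflexive (sym #b)))

nthElement-suc-≤ : NthElement S i a → NthElement S (suc i) b →
  ∀ {u} → u ∈ set S → a < u → b ≤ u
nthElement-suc-≤ {S} {b = b} (a∈S , #a) (_ , #b) {u} u∈S a<u =
  count-cancel-≤ (member? S) u∈S
    (subst (_≤ elementsBelow S u) (trans (cong suc #a) (sym #b))
      (count-mono-< (member? S) a∈S a<u))

nthGap-suc : NthGap S i f → NthGap S (suc i) f′ → suc (gapsBelow S f′) ≡ gapsBelow S f
nthGap-suc {i = i} (_ , #f) (_ , #f′) =
  +-cancelʳ-≡ (suc i) _ _ (trans (sym (+-suc _ (suc i))) (trans #f′ (sym #f)))

nthGap-suc-< : NthGap S i f → NthGap S (suc i) f′ → f′ < f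
nthGap-suc-< {S} nf nf′ = count-cancel-< (gap? S) (≤-reflexive (nthGap-suc {S} nf nf′))

nthGap-suc-≤ : NthGap S i f → NthGap S (suc i) f′ →
  ∀ {y} → y ∉ set S → y < f → y ≤ f′
nthGap-suc-≤ {S} nf nf′ {y} y∉S y<f = count-cancel-≤ (gap? S) (proj₁ nf′)
  (m<1+n⇒m≤n (subst (gapsBelow S y <_) (sym (nthGap-suc {S} nf nf′))
    (count-mono-< (gap? S) y∉S y<f)))

nthGap-zero-max : NthGap S 0 f → ∀ {y} → y ∉ set S → y ≤ f
nthGap-zero-max {S} (f∉S , #f) {y} y∉S = count-cancel-≤ (gap? S) f∉S
  (m<1+n⇒m≤n (subst (gapsBelow S y <_) (trans (sym #f) (+-comm _ 1)) (gapsBelow<genus S y∉S)))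

nthElement-zero : NthElement S 0 a → a ≡ 0
nthElement-zero {S} {zero}  _        = refl
nthElement-zero {S} {suc a} (_ , #a) =
  contradiction #a (m<n⇒n≢0 (count-mono-< (member? S) (0∈ S) (s≤s z≤n)))

-- There are a - j gaps below a and g - (i + 1) below f, so the numerical hypothesis says that a has
-- no more gaps below it than f. With f < a the gap f would be one more, and f = a is impossible for
-- an element and a gap.
nthElement<nthGap : ∀ {j} → NthElement S j a → NthGap S i f → a + suc i ≤ j + genus S → a < f
nthElement<nthGap {S} {a} {i} {f} {j} (a∈S , #a) (f∉S , #f) a+1+i≤j+g =
  ≰⇒> λ f≤a → case m≤n⇒m<n∨m≡n f≤a of λ where
    (inj₂ refl) → f∉S a∈S
    (inj₁ f<a)  → <⇒≱ (count-mono-< (gap? S) f∉S f<a) #gaps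
  where
  open ≤-Reasoning
  #gaps : gapsBelow S a ≤ gapsBelow S f
  #gaps = +-cancelˡ-≤ j _ _ (+-cancelʳ-≤ (suc i) _ _ (begin
    j + gapsBelow S a + suc i               ≡⟨ cong (λ z → z + gapsBelow S a + suc i) #a ⟨
    elementsBelow S a + gapsBelow S a + suc i ≡⟨ cong (_+ suc i) (count-∁ (member? S) a) ⟩
    a + suc i                               ≤⟨ a+1+i≤j+g ⟩
    j + genus S                             ≡⟨ cong (λ z → j + z) #f ⟨
    j + (gapsBelow S f + suc i)             ≡⟨ +-assoc j _ _ ⟨
    j + gapsBelow S f + suc i               ∎))

-- Consequences of the bound given by L(S)

elementsBelow-genus : (S : NumericalSemigroup) → elementsBelow S (suc (genus S)) ≡ suc (l S)
elementsBelow-genus S = trans (elementsBelow-suc S (genus S)) (cong suc (sym l≡))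
  where
  l≡ : l S ≡ count (member? S ∘ suc) (genus S)
  l≡ = trans (cong (length ∘ filter (member? S)) (map-upTo suc (genus S)))
             (length-filter-applyUpTo suc (member? S) (genus S))

2*m<2*n+1⇒m≤n : ∀ m n → 2 * m < 2 * n + 1 → m ≤ n
2*m<2*n+1⇒m≤n m n lt =
  *-cancelˡ-≤ 2 (m<1+n⇒m≤n (subst (2 * m <_) (+-comm (2 * n) 1) lt))

-- Let e be the number of elements below g. If g is in S, then e = l and L = 2e; otherwise e = l + 1
-- and L = 2e - 1. In both cases 2i < L forces i < e.
2*i<L⇒i<elementsBelow : (S : NumericalSemigroup) (i : ℕ) →
  2 * i < L S → i < elementsBelow S (genus S)
2*i<L⇒i<elementsBelow S i 2i<L with member? S (genus S) | elementsBelow-genus S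
... | yes g∈S | #g = subst (i <_) (sym (suc-injective #g)) (*-cancelˡ-< 2 i (l S) 2i<L)
... | no _    | #g = subst (i <_) (sym #g) (s≤s (2*m<2*n+1⇒m≤n i (l S) 2i<L))

1+2*i<L⇒i<l : (S : NumericalSemigroup) (i : ℕ) → suc (2 * i) < L S → i < l S
1+2*i<L⇒i<l S i 1+2i<L with does (member? S (genus S))
... | true  = *-cancelˡ-< 2 i (l S) (<-trans ≤-refl 1+2i<L)
... | false = *-cancelˡ-< 2 i (l S) (s<s⁻¹ (subst (suc (2 * i) <_) (+-comm (2 * l S) 1) 1+2i<L))

elementsBelow≤ : (S : NumericalSemigroup) (n : ℕ) → elementsBelow S n ≤ n
elementsBelow≤ S n = subst (elementsBelow S n ≤_) (count-∁ (member? S) n) (m≤m+n _ _)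

module EvenRange (S : NumericalSemigroup) (i : ℕ) (2i<L : 2 * i < L S) where

  i<#g : i < elementsBelow S (genus S)
  i<#g = 2*i<L⇒i<elementsBelow S i 2i<L

  F-nth′ : NthGap S i (F S (suc i))
  F-nth′ = F-nth S (<-≤-trans i<#g (elementsBelow≤ S (genus S)))

  -- More than i elements lie below g, so m_i < g, which is the hypothesis of `nthElement<nthGap`
  -- for j = i.
  m<F : m S i < F S (suc i)
  m<F = nthElement<nthGap {S} (m-nth S i) F-nth′ (begin
    m S i + suc i  ≡⟨ +-comm (m S i) (suc i) ⟩
    suc i + m S i  ≡⟨ +-suc i (m S i) ⟨
    i + suc (m S i) ≤⟨ +-monoʳ-≤ i (count-cancel-< (member? S)
                        (subst (_< _) (sym (proj₂ (m-nth S i))) i<#g)) ⟩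
    i + genus S ∎)
    where open ≤-Reasoning

-- Here i + 1 ≤ l gives m_{i+1} ≤ g, enough for `nthElement<nthGap` with j = i + 1.
m-suc<F : (S : NumericalSemigroup) (i : ℕ) → suc (2 * i) < L S → m S (suc i) < F S (suc i)
m-suc<F S i 1+2i<L = nthElement<nthGap {S} (m-nth S (suc i))
  (EvenRange.F-nth′ S i (<-trans ≤-refl 1+2i<L)) (begin
    m S (suc i) + suc i ≡⟨ +-comm (m S (suc i)) (suc i) ⟩
    suc i + m S (suc i) ≤⟨ +-monoʳ-≤ (suc i) (m<1+n⇒m≤n (count-cancel-< (member? S)
       (subst₂ _<_ (sym (proj₂ (m-nth S (suc i)))) (sym (elementsBelow-genus S))
         (s≤s (1+2*i<L⇒i<l S i 1+2i<L))))) ⟩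
    suc i + genus S ∎)
  where
  open ≤-Reasoning

-- The gaps of the iterates

-- Here T stands for A⋆^ (2 * i) S, a for m_i and f for F_{i+1}.
EvenShape : (S T : NumericalSemigroup) → ℕ → ℕ → Set
EvenShape S T a f =
  (∀ x → x ∉ set T ⇔ (x + a ∉ set S × x + a ≤ f)) × genus T + a ≡ genus S

-- Here T stands for A⋆^ (2 * i + 1) S, b for m_{i+1} and f for F_{i+1}.
OddShape : (S T : NumericalSemigroup) → ℕ → ℕ → Set
OddShape S T b f =
  (∀ x → x ∉ set T ⇔ (∃ λ u → u ∈ set S × b ≤ u × x + u ≡ f)) × genus T + genus S ≡ f

open Equivalence using (to; from)

evenShape-zero : NthElement S 0 a → NthGap S 0 f → EvenShape S S a f
evenShape-zero {S} na nf with refl ← nthElement-zero {S} na =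
  (λ x → subst (λ y → x ∉ set S ⇔ (y ∉ set S × y ≤ _)) (sym (+-identityʳ x))
    (mk⇔ (λ x∉S → x∉S , nthGap-zero-max {S} nf x∉S) proj₁)) ,
  +-identityʳ _

evenShape-frobenius : EvenShape S T a f → f ∉ set S → a < f → IsFrobenius T (f ∸ a)
evenShape-frobenius {S} {T} {a} {f} (shape , _) f∉S a<f =
  from (shape _) (subst (λ y → y ∉ set S × y ≤ f) (sym (m∸n+n≡m (<⇒≤ a<f))) (f∉S , ≤-refl)) ,
  λ {x} x∉T → m+n≤o⇒m≤o∸n x (proj₂ (to (shape x) x∉T))

oddShape-frobenius : OddShape S T b f → b ∈ set S → b < f → IsFrobenius T (f ∸ b)
oddShape-frobenius {b = b} (shape , _) b∈S b<f =
  from (shape _) (b , b∈S , ≤-refl , m∸n+n≡m (<⇒≤ b<f)) ,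
  λ {x} x∉T → case to (shape x) x∉T of λ where
    (u , _ , b≤u , refl) → m+n≤o⇒m≤o∸n x (+-monoʳ-≤ x b≤u)

-- The gaps of A⋆ T are the (f - a) - s = f - u with s a nonzero element of T and u = s + a. In the
-- range u ≤ f, s is in T exactly when u is in S, and s ≠ 0 means u > m_i, hence u ≥ m_{i+1}.
evenShape⇒oddShape : NthElement S i a → NthElement S (suc i) b → NthGap S i f → a < f →
  EvenShape S T a f → AlmostSymmetric T → OddShape S (A⋆ T) b f
evenShape⇒oddShape {S} {i} {a} {b} {f} {T} na nb (f∉S , _) a<f even@(shape , genus≡) as =
  (λ x → mk⇔ (to′ x) (from′ x)) , (begin
    genus (A⋆ T) + genus S         ≡⟨ cong (λ z → genus (A⋆ T) + z) genus≡ ⟨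
    genus (A⋆ T) + (genus T + a)   ≡⟨ +-assoc (genus (A⋆ T)) (genus T) a ⟨
    genus (A⋆ T) + genus T + a     ≡⟨ cong (_+ a) (genus-A⋆-almostSymmetric {T} frob as) ⟩
    f ∸ a + a                      ≡⟨ m∸n+n≡m (<⇒≤ a<f) ⟩
    f                              ∎)
  where
  open ≡-Reasoning
  frob : IsFrobenius T (f ∸ a)
  frob = evenShape-frobenius {S} {T} even f∉S a<f

  a<b : a < b
  a<b = nthElement-suc-< {S} na nb

  to′ : ∀ x → x ∉ set (A⋆ T) → ∃ λ u → u ∈ set S × b ≤ u × x + u ≡ f
  to′ x x∉A⋆ = go (gap⇒reflected {T} frob as x∉A⋆)
    where
    go : (∃ λ s → s ∈ set T × s ≢ 0 × x + s ≡ f ∸ a) → ∃ λ u → u ∈ set S × b ≤ u × x + u ≡ f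
    go (s , s∈T , s≢0 , x+s≡) =
      s + a , s+a∈S , nthElement-suc-≤ {S} na nb s+a∈S (m<n+m a (n≢0⇒n>0 s≢0)) , x+u≡f
      where
      x+u≡f : x + (s + a) ≡ f
      x+u≡f = begin
        x + (s + a) ≡⟨ +-assoc x s a ⟨
        x + s + a   ≡⟨ cong (_+ a) x+s≡ ⟩
        f ∸ a + a   ≡⟨ m∸n+n≡m (<⇒≤ a<f) ⟩
        f           ∎
      s+a∈S : s + a ∈ set S
      -- If `s + a`, which is at most f, were a gap of S, then s would be a gap of T.
      s+a∈S = decidable-stable (member? S (s + a)) λ s+a∉S →
        from (shape s) (s+a∉S , subst (s + a ≤_) x+u≡f (m≤n+m _ x)) s∈T

  from′ : ∀ x → (∃ λ u → u ∈ set S × b ≤ u × x + u ≡ f) → x ∉ set (A⋆ T)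
  from′ x (u , u∈S , b≤u , refl) =
    reflected⇒gap {T} frob u∸a∈T (m<n⇒n≢0 (m<n⇒0<n∸m a<u)) (sym (+-∸-assoc x (<⇒≤ a<u)))
    where
    a<u : a < u
    a<u = <-≤-trans a<b b≤u
    u∸a∈T : u ∸ a ∈ set T
    u∸a∈T = decidable-stable (member? T (u ∸ a)) λ u∸a∉T →
      proj₁ (to (shape (u ∸ a)) u∸a∉T) (subst (set S) (sym (m∸n+n≡m (<⇒≤ a<u))) u∈S)

-- A gap x = (f - b) - s of A⋆ T has x + b = f - s. By the shape of T, s is in T exactly when x + b
-- is a gap of S, and s ≠ 0 puts that gap below F_{i+1}, hence at most F_{i+2}.
oddShape⇒evenShape : b ∈ set S → NthGap S i f → NthGap S (suc i) f′ → b < f →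
  OddShape S T b f → AlmostSymmetric T → EvenShape S (A⋆ T) b f′
oddShape⇒evenShape {b} {S} {i} {f} {f′} {T} b∈S nf nf′ b<f odd@(shape , genus≡) as =
  (λ x → mk⇔ (to′ x) (from′ x)) , +-cancelˡ-≡ (genus T) _ _ (begin
    genus T + (genus (A⋆ T) + b)   ≡⟨ rearrange (genus T) (genus (A⋆ T)) b ⟩
    genus (A⋆ T) + genus T + b     ≡⟨ cong (_+ b) (genus-A⋆-almostSymmetric {T} frob as) ⟩
    f ∸ b + b                      ≡⟨ m∸n+n≡m (<⇒≤ b<f) ⟩
    f                              ≡⟨ genus≡ ⟨
    genus T + genus S              ∎)
  where
  open ≡-Reasoning
  frob : IsFrobenius T (f ∸ b)
  frob = oddShape-frobenius {S} {T} odd b∈S b<f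

  rearrange : ∀ x y z → x + (y + z) ≡ y + x + z
  rearrange = ℕ-solve-∀

  to′ : ∀ x → x ∉ set (A⋆ T) → x + b ∉ set S × x + b ≤ f′
  to′ x x∉A⋆ = go (gap⇒reflected {T} frob as x∉A⋆)
    where
    go : (∃ λ s → s ∈ set T × s ≢ 0 × x + s ≡ f ∸ b) → x + b ∉ set S × x + b ≤ f′
    go (s , s∈T , s≢0 , x+s≡) =
      x+b∉S , nthGap-suc-≤ {S} nf nf′ x+b∉S
        (subst (x + b <_) s+[x+b]≡f (m<n+m (x + b) (n≢0⇒n>0 s≢0)))
      where
      s+[x+b]≡f : s + (x + b) ≡ f
      s+[x+b]≡f = begin
        s + (x + b) ≡⟨ rearrange s x b ⟩
        x + s + b   ≡⟨ cong (_+ b) x+s≡ ⟩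
        f ∸ b + b   ≡⟨ m∸n+n≡m (<⇒≤ b<f) ⟩
        f           ∎
      x+b∉S : x + b ∉ set S
      x+b∉S x+b∈S = from (shape s) (x + b , x+b∈S , m≤n+m b x , s+[x+b]≡f) s∈T

  from′ : ∀ x → x + b ∉ set S × x + b ≤ f′ → x ∉ set (A⋆ T)
  from′ x (x+b∉S , x+b≤f′) =
    reflected⇒gap {T} frob s∈T (m<n⇒n≢0 (m<n⇒0<n∸m x+b<f)) x+s≡
    where
    s : ℕ
    s = f ∸ (x + b)
    x+b<f : x + b < f
    x+b<f = ≤-<-trans x+b≤f′ (nthGap-suc-< {S} nf nf′)
    s+[x+b]≡f : s + (x + b) ≡ f
    s+[x+b]≡f = m∸n+n≡m (<⇒≤ x+b<f)
    s∈T : s ∈ set T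
    -- A gap s of T would be f - u with u in S; cancellation gives u = x + b, a gap of S.
    s∈T = decidable-stable (member? T s) λ s∉T → case to (shape s) s∉T of λ where
      (u , u∈S , _ , s+u≡f) → x+b∉S
        (subst (set S) (+-cancelˡ-≡ s u (x + b) (trans s+u≡f (sym s+[x+b]≡f))) u∈S)
    x+s≡ : x + s ≡ f ∸ b
    x+s≡ = begin
      x + s           ≡⟨ m+n∸n≡m (x + s) b ⟨
      x + s + b ∸ b   ≡⟨ cong (_∸ b) (rearrange s x b) ⟨
      s + (x + b) ∸ b ≡⟨ cong (_∸ b) s+[x+b]≡f ⟩
      f ∸ b           ∎

-- Almost symmetry as an equation for the type

almostSymmetric⇔type : IsFrobenius T f → ∀ {z} →
  + (2 * genus T) ℤ.- + f ≡ z → AlmostSymmetric T ⇔ + type T ≡ z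
almostSymmetric⇔type {T} frob refl with refl ← frobenius-unique {T} frob =
  -- The Frobenius number is itself a gap, which supplies T ≠ ℕ.
  mk⇔ proj₂ λ eq → (λ whole → proj₁ frob (whole _)) , eq

evenShape⇒type : f ∉ set S → a < f → EvenShape S T a f →
  AlmostSymmetric T ⇔ + type T ≡ + (2 * genus S) ℤ.- + a ℤ.- + f
evenShape⇒type {f} {S} {a} {T} f∉S a<f even@(_ , genus≡) =
  almostSymmetric⇔type {T} (evenShape-frobenius {S} {T} even f∉S a<f) (begin
    + (2 * genus T) ℤ.- + (f ∸ a)
      ≡⟨ identity (+ genus T) (+ a) (+ (f ∸ a)) ⟩
    + (2 * (genus T + a)) ℤ.- + a ℤ.- + (f ∸ a + a)
      ≡⟨ cong₂ (λ g h → + (2 * g) ℤ.- + a ℤ.- + h) genus≡ (m∸n+n≡m (<⇒≤ a<f)) ⟩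
    + (2 * genus S) ℤ.- + a ℤ.- + f ∎)
  where
  open ≡-Reasoning
  -- Stated with `γ + (γ + 0)` because `2 * n` computes to that form and `+_` commutes with sums by
  -- computation.
  identity : ∀ γ x h → (γ ℤ.+ (γ ℤ.+ + 0)) ℤ.- h ≡
    ((γ ℤ.+ x) ℤ.+ ((γ ℤ.+ x) ℤ.+ + 0)) ℤ.- x ℤ.- (h ℤ.+ x)
  identity = ℤ-solve-∀

oddShape⇒type : b ∈ set S → b < f → OddShape S T b f →
  AlmostSymmetric T ⇔ + type T ≡ + f ℤ.- + (2 * genus S) ℤ.+ + b
oddShape⇒type {b} {S} {f} {T} b∈S b<f odd@(_ , genus≡) =
  almostSymmetric⇔type {T} (oddShape-frobenius {S} {T} odd b∈S b<f) (begin
    + (2 * genus T) ℤ.- + (f ∸ b)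
      -- Twice g(T) is written as two copies of g(T) + g(S) minus 2g(S), so that f can replace both
      -- copies.
      ≡⟨ identity (+ genus T) (+ genus S) (+ (f ∸ b)) ⟩
    + (genus T + genus S) ℤ.- + (2 * genus S) ℤ.+ (+ (genus T + genus S) ℤ.- + (f ∸ b))
      ≡⟨ cong (λ h → + h ℤ.- + (2 * genus S) ℤ.+ (+ h ℤ.- + (f ∸ b))) genus≡ ⟩
    + f ℤ.- + (2 * genus S) ℤ.+ (+ f ℤ.- + (f ∸ b))
      ≡⟨ cong (λ h → + f ℤ.- + (2 * genus S) ℤ.+ (+ h ℤ.- + (f ∸ b))) (m∸n+n≡m (<⇒≤ b<f)) ⟨
    + f ℤ.- + (2 * genus S) ℤ.+ (+ (f ∸ b + b) ℤ.- + (f ∸ b))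
      ≡⟨ cong (λ z → + f ℤ.- + (2 * genus S) ℤ.+ z) (cancel (+ (f ∸ b)) (+ b)) ⟩
    + f ℤ.- + (2 * genus S) ℤ.+ + b ∎)
  where
  open ≡-Reasoning
  identity : ∀ γ g h → (γ ℤ.+ (γ ℤ.+ + 0)) ℤ.- h ≡
    (γ ℤ.+ g) ℤ.- (g ℤ.+ (g ℤ.+ + 0)) ℤ.+ ((γ ℤ.+ g) ℤ.- h)
  identity = ℤ-solve-∀
  cancel : ∀ h x → (h ℤ.+ x) ℤ.- h ≡ x
  cancel = ℤ-solve-∀

-- Induction along the iterates

AlmostSymmetricBelow : NumericalSemigroup → ℕ → Set
AlmostSymmetricBelow S n = ∀ j → j < n → AlmostSymmetric (A⋆^ j S)

below-pred : ∀ {n} → AlmostSymmetricBelow S (suc n) → AlmostSymmetricBelow S n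
below-pred below j j<n = below j (m<n⇒m<1+n j<n)

mutual
  -- The recursion alternates between parities. Each application of A⋆ consumes the almost symmetry
  -- of the iterate just before it, so only earlier iterates are assumed almost symmetric.
  evenShape : (S : NumericalSemigroup) (i : ℕ) → 2 * i < L S →
    AlmostSymmetricBelow S (2 * i) → EvenShape S (A⋆^ (2 * i) S) (m S i) (F S (suc i))
  evenShape S zero    lt below = evenShape-zero {S} (m-nth S 0) (EvenRange.F-nth′ S 0 lt)
  -- `2 * suc i` exposes only one `suc` by computation; the transport to `2 + 2 * i` makes both
  -- applications of `A⋆` visible.
  evenShape S (suc i) = subst
    (λ n → n < L S → AlmostSymmetricBelow S n →
           EvenShape S (A⋆^ n S) (m S (suc i)) (F S (suc (suc i))))
    (sym (*-suc 2 i)) (evenShape-suc S i)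

  evenShape-suc : (S : NumericalSemigroup) (i : ℕ) → 2 + 2 * i < L S →
    AlmostSymmetricBelow S (2 + 2 * i) →
    EvenShape S (A⋆^ (2 + 2 * i) S) (m S (suc i)) (F S (suc (suc i)))
  evenShape-suc S i lt below =
    oddShape⇒evenShape {S = S} {T = A⋆^ (suc (2 * i)) S} (proj₁ (m-nth S (suc i)))
      (EvenRange.F-nth′ S i (<-trans (n<1+n _) lt′))
      (EvenRange.F-nth′ S (suc i) (subst (_< L S) (sym (*-suc 2 i)) lt))
      (m-suc<F S i lt′)
      (oddShape S i lt′ (below-pred {S} below))
      (below (suc (2 * i)) (n<1+n _))
    where
    lt′ : suc (2 * i) < L S
    lt′ = <-trans (n<1+n _) lt

  oddShape : (S : NumericalSemigroup) (i : ℕ) → suc (2 * i) < L S →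
    AlmostSymmetricBelow S (suc (2 * i)) →
    OddShape S (A⋆^ (suc (2 * i)) S) (m S (suc i)) (F S (suc i))
  oddShape S i lt below =
    evenShape⇒oddShape {S} {T = A⋆^ (2 * i) S} (m-nth S i) (m-nth S (suc i)) F-nth′ m<F
      (evenShape S i lt′ (below-pred {S} below)) (below (2 * i) (n<1+n _))
    where
    lt′ : 2 * i < L S
    lt′ = <-trans (n<1+n _) lt
    open EvenRange S i lt′

even-step : (S : NumericalSemigroup) (i : ℕ) → 2 * i < L S → AlmostSymmetricBelow S (2 * i) →
  AlmostSymmetric (A⋆^ (2 * i) S) ⇔
  + type (A⋆^ (2 * i) S) ≡ + (2 * genus S) ℤ.- + m S i ℤ.- + F S (i + 1)
even-step S i lt below = subst
  (λ n → AlmostSymmetric (A⋆^ (2 * i) S) ⇔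
         + type (A⋆^ (2 * i) S) ≡ + (2 * genus S) ℤ.- + m S i ℤ.- + F S n)
  (+-comm 1 i)
  (evenShape⇒type {S = S} {T = A⋆^ (2 * i) S} (proj₁ F-nth′) m<F (evenShape S i lt below))
  where open EvenRange S i lt

odd-step : (S : NumericalSemigroup) (i : ℕ) → 2 * i + 1 < L S →
  AlmostSymmetricBelow S (2 * i + 1) →
  AlmostSymmetric (A⋆^ (2 * i + 1) S) ⇔
  + type (A⋆^ (2 * i + 1) S) ≡ + F S (i + 1) ℤ.- + (2 * genus S) ℤ.+ + m S (i + 1)
odd-step S i = subst₂
  (λ n n′ → n < L S → AlmostSymmetricBelow S n →
            AlmostSymmetric (A⋆^ n S) ⇔
            + type (A⋆^ n S) ≡ + F S n′ ℤ.- + (2 * genus S) ℤ.+ + m S n′)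
  (+-comm 1 (2 * i)) (+-comm 1 i)
  λ lt below → oddShape⇒type {S = S} {T = A⋆^ (suc (2 * i)) S}
    (proj₁ (m-nth S (suc i))) (m-suc<F S i lt) (oddShape S i lt below)

even⊎odd : ∀ n → ∃ λ i → n ≡ 2 * i ⊎ n ≡ 2 * i + 1
even⊎odd zero    = 0 , inj₁ refl
even⊎odd (suc n) with even⊎odd n
... | i , inj₁ refl = i , inj₂ (+-comm 1 (2 * i))
... | i , inj₂ refl = suc i , inj₁ (trans (cong suc (+-comm (2 * i) 1)) (sym (*-suc 2 i)))

theorem1p4 : (S : NumericalSemigroup) (k : ℕ) → k < L S →
    (∀ j → j ≤ k → AlmostSymmetric (A⋆^ j S))
    ⇔
    ( (∀ i → 2 * i ≤ k →
    + type (A⋆^ (2 * i) S) ≡ + (2 * genus S) ℤ.- + m S i ℤ.- + F S (i + 1))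
    × (∀ i → 2 * i + 1 ≤ k →
    + type (A⋆^ (2 * i + 1) S) ≡ + F S (i + 1) ℤ.- + (2 * genus S) ℤ.+ + m S (i + 1)))
theorem1p4 S k k<L = mk⇔
  (λ as →
    (λ i 2i≤k → to (even-step S i (≤-<-trans 2i≤k k<L)
      (λ _ j< → as _ (<⇒≤ (<-≤-trans j< 2i≤k)))) (as _ 2i≤k)) ,
    (λ i 2i+1≤k → to (odd-step S i (≤-<-trans 2i+1≤k k<L)
      (λ _ j< → as _ (<⇒≤ (<-≤-trans j< 2i+1≤k)))) (as _ 2i+1≤k)))
  -- The j-th equation yields almost symmetry only once all earlier iterates have it, hence strong
  -- induction; in the other direction this is part of the hypothesis.
  λ (evens , odds) → <-rec _ λ j below j≤k →
    let below′ : AlmostSymmetricBelow S j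
        below′ _ j′<j = below j′<j (<⇒≤ (<-≤-trans j′<j j≤k))
    in case even⊎odd j of λ where
      (i , inj₁ refl) → from (even-step S i (≤-<-trans j≤k k<L) below′) (evens i j≤k)
      (i , inj₂ refl) → from (odd-step S i (≤-<-trans j≤k k<L) below′) (odds i j≤k)
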